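{- For every integer $\ell\geq 1$ there is a first-order prenex sentence $\varphi_\ell$ over $\tau_{\mathsf{ord}}$ that is true in $L_\ell$ and false in $L_m$ for every $m\geq 1$ with $m\neq \ell$, such that $\varphi_\ell$ has at most $q^*(\ell)+2$ quantifiers and its quantifier prefix strictly alternates between $\exists$ and $\forall$ and ends with $\forall$.
   Context: Vocabulary $\tau_{\mathsf{ord}} = \langle < ;\ \mathsf{min}, \mathsf{max}\rangle$ with $<$ binary and $\mathsf{min},\mathsf{max}$ constants. For $\ell \geq 1$, $L_\ell$ is the linear order with $\ell+1$ elements (its length is $\ell$), with $\mathsf{min},\mathsf{max}$ interpreted as first and last elements. Define $q^*_\forall, q^*_\exists : \mathbb{Z}_{\geq 1}\to\mathbb{N}$ by $q^*_\forall(1)=1$, $q^*_\exists(1)=2$, $q^*_\forall(2)=2$, and $q^*_\exists(2\ell) = q^*_\forall(\ell)+1$ ($\ell\geq 1$); $q^*_\exists(2\ell+1) = q^*_\forall(\ell+1)+1$ ($\ell \geq 1$); $q^*_\forall(2\ell) = q^*_\exists(\ell)+1$ ($\ell\geq 2$); $q^*_\forall(2\ell+1) = q^*_\exists(\ell)+1$ ($\ell\geq 1$). Let $q^*(\ell) = \min(q^*_\exists(\ell), q^*_\forall(\ell))$. -}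

module Defs where

open import Data.Empty using (⊥)
open import Data.Fin as Fin using (Fin)
open import Data.List using (List; []; _∷_)
open import Data.Nat using (ℕ; suc; _+_; _*_; _⊓_; _<_; _≥_; s≤s; ⌊_/2⌋; ⌈_/2⌉)
open import Data.Nat.Induction using (<-wellFounded; Acc; acc)
open import Data.Nat.Properties
open import Data.Product using (Σ-syntax; _×_)
open import Data.Sum using (_⊎_)
open import Data.Vec using (Vec; []; _∷_; lookup)
open import Relation.Binary.PropositionalEquality
open import Relation.Nullary using (¬_)

-- First-order logic with equality over τ_ord = ⟨ < ; min , max ⟩.
-- The index n is the number of free variables (de Bruijn indices; variable 0
-- is bound by the innermost enclosing quantifier).

data Quantifier : Set where
  ex all : Quantifier

data Term (n : ℕ) : Set where
  var     : Fin n → Term n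
  min max : Term n

infix  8 _≈′_ _<′_
infixr 6 _∧′_
infixr 5 _∨′_
infixr 4 _⇒′_

data Formula (n : ℕ) : Set where
  _≈′_ _<′_       : Term n → Term n → Formula n
  ⊥′              : Formula n
  ¬′_             : Formula n → Formula n
  _∧′_ _∨′_ _⇒′_  : Formula n → Formula n → Formula n
  quant           : Quantifier → Formula (suc n) → Formula n

Sentence : Set
Sentence = Formula 0

data QuantifierFree {n : ℕ} : Formula n → Set where
  _≈′_ : ∀ s t → QuantifierFree (s ≈′ t)
  _<′_ : ∀ s t → QuantifierFree (s <′ t)
  ⊥′   : QuantifierFree ⊥′
  ¬′_  : ∀ {φ} → QuantifierFree φ → QuantifierFree (¬′ φ)
  _∧′_ : ∀ {φ ψ} → QuantifierFree φ → QuantifierFree ψ → QuantifierFree (φ ∧′ ψ)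
  _∨′_ : ∀ {φ ψ} → QuantifierFree φ → QuantifierFree ψ → QuantifierFree (φ ∨′ ψ)
  _⇒′_ : ∀ {φ ψ} → QuantifierFree φ → QuantifierFree ψ → QuantifierFree (φ ⇒′ ψ)

-- "φ is prenex with quantifier prefix Q" (outermost quantifier first).  The
-- matrix has no quantifiers, so φ has exactly length Q of them.
data PrenexWith {n : ℕ} : Formula n → List Quantifier → Set where
  matrix : ∀ {φ} → QuantifierFree φ → PrenexWith φ []
  prefix : ∀ {φ Q} q → PrenexWith φ Q → PrenexWith (quant q φ) (q ∷ Q)

record Structure : Set₁ where
  field
    Carrier : Set
    _≺_     : Carrier → Carrier → Set
    minᴬ    : Carrier
    maxᴬ    : Carrier

module _ (A : Structure) where
  open Structure A

  ⟦_⟧ᵗ : ∀ {n} → Term n → Vec Carrier n → Carrier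
  ⟦ var i ⟧ᵗ ρ = lookup ρ i
  ⟦ min   ⟧ᵗ ρ = minᴬ
  ⟦ max   ⟧ᵗ ρ = maxᴬ

  -- On the finite orders L ℓ below all atoms are decidable and quantifiers
  -- range over Fin, so this reading agrees with the classical one there.
  ⟦_⟧ : ∀ {n} → Formula n → Vec Carrier n → Set
  ⟦ s ≈′ t      ⟧ ρ = ⟦ s ⟧ᵗ ρ ≡ ⟦ t ⟧ᵗ ρ
  ⟦ s <′ t      ⟧ ρ = ⟦ s ⟧ᵗ ρ ≺ ⟦ t ⟧ᵗ ρ
  ⟦ ⊥′          ⟧ ρ = ⊥
  ⟦ ¬′ φ        ⟧ ρ = ¬ ⟦ φ ⟧ ρ
  ⟦ φ ∧′ ψ      ⟧ ρ = ⟦ φ ⟧ ρ × ⟦ ψ ⟧ ρ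
  ⟦ φ ∨′ ψ      ⟧ ρ = ⟦ φ ⟧ ρ ⊎ ⟦ ψ ⟧ ρ
  ⟦ φ ⇒′ ψ      ⟧ ρ = ⟦ φ ⟧ ρ → ⟦ ψ ⟧ ρ
  ⟦ quant ex φ  ⟧ ρ = Σ[ x ∈ Carrier ] ⟦ φ ⟧ (x ∷ ρ)
  ⟦ quant all φ ⟧ ρ = (x : Carrier) → ⟦ φ ⟧ (x ∷ ρ)

infix 3 _⊨_

_⊨_ : Structure → Sentence → Set
A ⊨ φ = ⟦_⟧ A φ []

-- ℓ is the length, so L ℓ has ℓ + 1 elements.
L : ℕ → Structure
L ℓ = record
  { Carrier = Fin (suc ℓ)
  ; _≺_     = Fin._<_
  ; minᴬ    = Fin.zero
  ; maxᴬ    = Fin.fromℕ ℓ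
  }

-- The even and odd clauses of the recurrences are merged using ⌊_/2⌋ and
-- ⌈_/2⌉; the clauses in their original form are proved below.  The value at 0
-- is junk: the functions are only meant on arguments ≥ 1.
mutual
  q*∀-acc : ∀ n → Acc _<_ n → ℕ
  q*∀-acc 0 _ = 0
  q*∀-acc 1 _ = 1
  q*∀-acc 2 _ = 2
  q*∀-acc n@(suc (suc (suc k))) (acc rs) =
    q*∃-acc ⌊ n /2⌋ (rs (⌊n/2⌋<n (2 + k))) + 1

  q*∃-acc : ∀ n → Acc _<_ n → ℕ
  q*∃-acc 0 _ = 0
  q*∃-acc 1 _ = 2
  q*∃-acc n@(suc (suc k)) (acc rs) =
    q*∀-acc ⌈ n /2⌉ (rs (⌈n/2⌉<n k)) + 1

q*∀ : ℕ → ℕ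
q*∀ n = q*∀-acc n (<-wellFounded n)

q*∃ : ℕ → ℕ
q*∃ n = q*∃-acc n (<-wellFounded n)

q* : ℕ → ℕ
q* ℓ = q*∃ ℓ ⊓ q*∀ ℓ

mutual
  q*∀-irr : ∀ n (a b : Acc _<_ n) → q*∀-acc n a ≡ q*∀-acc n b
  q*∀-irr 0 _ _ = refl
  q*∀-irr 1 _ _ = refl
  q*∀-irr 2 _ _ = refl
  q*∀-irr (suc (suc (suc k))) (acc _) (acc _) = cong (_+ 1) (q*∃-irr ⌊ 3 + k /2⌋ _ _)

  q*∃-irr : ∀ n (a b : Acc _<_ n) → q*∃-acc n a ≡ q*∃-acc n b
  q*∃-irr 0 _ _ = refl
  q*∃-irr 1 _ _ = refl
  q*∃-irr (suc (suc k)) (acc _) (acc _) = cong (_+ 1) (q*∀-irr ⌈ 2 + k /2⌉ _ _)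

q*∀-step : ∀ n → n ≥ 3 → q*∀ n ≡ q*∃ ⌊ n /2⌋ + 1
q*∀-step (suc (suc (suc k))) _ with <-wellFounded (3 + k)
... | acc _ = cong (_+ 1) (q*∃-irr ⌊ 3 + k /2⌋ _ _)
q*∀-step 1 (s≤s ())
q*∀-step 2 (s≤s (s≤s ()))

q*∃-step : ∀ n → n ≥ 2 → q*∃ n ≡ q*∀ ⌈ n /2⌉ + 1
q*∃-step (suc (suc k)) _ with <-wellFounded (2 + k)
... | acc _ = cong (_+ 1) (q*∀-irr ⌈ 2 + k /2⌉ _ _)
q*∃-step 1 (s≤s ())

⌊2n/2⌋≡n : ∀ n → ⌊ 2 * n /2⌋ ≡ n
⌊2n/2⌋≡n n = trans (cong (λ k → ⌊ n + k /2⌋) (+-identityʳ n)) (sym (n≡⌊n+n/2⌋ n))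

⌈2n/2⌉≡n : ∀ n → ⌈ 2 * n /2⌉ ≡ n
⌈2n/2⌉≡n n = trans (cong (λ k → ⌈ n + k /2⌉) (+-identityʳ n)) (sym (n≡⌈n+n/2⌉ n))

⌊2n+1/2⌋≡n : ∀ n → ⌊ 2 * n + 1 /2⌋ ≡ n
⌊2n+1/2⌋≡n n = trans (cong ⌊_/2⌋ (+-comm (2 * n) 1)) (⌈2n/2⌉≡n n)

⌈2n+1/2⌉≡n+1 : ∀ n → ⌈ 2 * n + 1 /2⌉ ≡ n + 1
⌈2n+1/2⌉≡n+1 n = trans (cong ⌈_/2⌉ (+-comm (2 * n) 1))
                (trans (cong suc (⌊2n/2⌋≡n n)) (+-comm 1 n))

q*∀-1 : q*∀ 1 ≡ 1
q*∀-1 = refl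

q*∃-1 : q*∃ 1 ≡ 2
q*∃-1 = refl

q*∀-2 : q*∀ 2 ≡ 2
q*∀-2 = refl

q*∃-even : ∀ ℓ → ℓ ≥ 1 → q*∃ (2 * ℓ) ≡ q*∀ ℓ + 1
q*∃-even ℓ ℓ≥1 = trans (q*∃-step (2 * ℓ) (*-monoʳ-≤ 2 ℓ≥1))
                       (cong (λ k → q*∀ k + 1) (⌈2n/2⌉≡n ℓ))

q*∃-odd : ∀ ℓ → ℓ ≥ 1 → q*∃ (2 * ℓ + 1) ≡ q*∀ (ℓ + 1) + 1
q*∃-odd ℓ ℓ≥1 = trans (q*∃-step (2 * ℓ + 1) (m≤n⇒m≤n+o 1 (*-monoʳ-≤ 2 ℓ≥1)))
                      (cong (λ k → q*∀ k + 1) (⌈2n+1/2⌉≡n+1 ℓ))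

q*∀-even : ∀ ℓ → ℓ ≥ 2 → q*∀ (2 * ℓ) ≡ q*∃ ℓ + 1
q*∀-even ℓ ℓ≥2 = trans (q*∀-step (2 * ℓ) (≤-trans (n≤1+n 3) (*-monoʳ-≤ 2 ℓ≥2)))
                       (cong (λ k → q*∃ k + 1) (⌊2n/2⌋≡n ℓ))

q*∀-odd : ∀ ℓ → ℓ ≥ 1 → q*∀ (2 * ℓ + 1) ≡ q*∃ ℓ + 1
q*∀-odd ℓ ℓ≥1 = trans (q*∀-step (2 * ℓ + 1) (+-monoˡ-≤ 1 (*-monoʳ-≤ 2 ℓ≥1)))
                      (cong (λ k → q*∃ k + 1) (⌊2n+1/2⌋≡n ℓ))

{-# OPTIONS --safe #-}

-- Write D k s t for t ≤ k + s.  Then D (a + b + 1) s t iff every y satisfies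
-- D a s y or D b y t, and D (a + b) s t iff some z satisfies D a s z and
-- D b z t.  A conjunction of two universal statements about the adjacent
-- intervals [s,z) and [z,t) is merged into one universal quantifier by asking
-- whether its variable lies below z; dually for disjunctions of existential
-- statements.  So each further quantifier of an alternating prefix doubles
-- (roughly) the length that can be bounded.  Length exactly ℓ is "≤ ℓ and not
-- ≤ ℓ - 1": the outer universal quantifier refutes all ways of halving ℓ - 1 at
-- points y ≠ max, and its spare value y = max is used to assert "≤ ℓ".

module Submission where

open import Defs
open import Data.Empty using (⊥)
open import Data.Fin as Fin using (Fin; toℕ; fromℕ<)
open import Data.Fin.Properties as Finₚ using (toℕ<n; toℕ-fromℕ; toℕ-fromℕ<; any?; all?; ¬∀⟶∃¬)
open import Data.List using (List; []; _∷_; length; last; map)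
open import Data.List.Relation.Unary.Linked using (Linked; []; [-]; _∷_)
open import Data.Maybe using (just)
open import Data.Nat using (ℕ; zero; suc; _+_; _*_; _∸_; _⊔_; _≤_; _<_; _≥_; z≤n; s≤s; s≤s⁻¹; _<?_; _≤?_; ⌊_/2⌋; ⌈_/2⌉)
open import Data.Nat.Properties
open import Data.Product using (Σ; Σ-syntax; _×_; _,_; proj₁; proj₂)
open import Data.Sum using (_⊎_; inj₁; inj₂; [_,_]′)
open import Data.Unit using (⊤; tt)
open import Data.Vec using (Vec; []; _∷_)
open import Function using (_∘_; _⇔_; mk⇔)
open import Function.Bundles using (module Equivalence)
open import Relation.Binary.PropositionalEquality using (_≡_; _≢_; refl; sym; trans; cong; subst)
open import Relation.Nullary using (¬_; Dec; yes; no; contradiction)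
open import Relation.Nullary.Decidable using (_×-dec_; _⊎-dec_; _→-dec_; ¬?)

open Equivalence using (to; from)

-- Alternating prefixes

dual : Quantifier → Quantifier
dual ex  = all
dual all = ex

alternating : Quantifier → ℕ → List Quantifier
alternating q zero    = []
alternating q (suc n) = q ∷ alternating (dual q) n

length-alternating : ∀ q n → length (alternating q n) ≡ n
length-alternating q zero    = refl
length-alternating q (suc n) = cong suc (length-alternating (dual q) n)

≢-dual : ∀ q → q ≢ dual q
≢-dual ex  ()
≢-dual all ()

linked-alternating : ∀ q n → Linked _≢_ (alternating q n)
linked-alternating q zero          = []
linked-alternating q (suc zero)    = [-]
linked-alternating q (suc (suc n)) = ≢-dual q ∷ linked-alternating (dual q) (suc n)

last-alternating : ∀ j → last (alternating all (suc (j * 2))) ≡ just all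
last-alternating zero    = refl
last-alternating (suc j) = last-alternating j

map-dual-alternating : ∀ q n → map dual (alternating q n) ≡ alternating (dual q) n
map-dual-alternating q zero    = refl
map-dual-alternating q (suc n) = cong (dual q ∷_) (map-dual-alternating (dual q) n)

-- Definability over the finite linear orders

Env : ℕ → ℕ → Set
Env m n = Vec (Fin (suc m)) n

weaken : ∀ {n} → Term n → Term (suc n)
weaken (var i) = var (Fin.suc i)
weaken min     = min
weaken max     = max

val : ∀ {n} m → Term n → Env m n → ℕ
val m t ρ = toℕ (⟦_⟧ᵗ (L m) t ρ)

val-weaken : ∀ {n} m (t : Term n) x ρ → val m (weaken t) (x ∷ ρ) ≡ val m t ρ
val-weaken m (var i) x ρ = refl
val-weaken m min     x ρ = refl
val-weaken m max     x ρ = refl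

val≤ : ∀ {n} m (t : Term n) ρ → val m t ρ ≤ m
val≤ m t ρ = s≤s⁻¹ (toℕ<n (⟦_⟧ᵗ (L m) t ρ))

Quant : Quantifier → (A : Set) → (A → Set) → Set
Quant ex  A P = Σ A P
Quant all A P = (x : A) → P x

quant-⇔ : ∀ q {A : Set} {P P′ : A → Set} → (∀ x → P x ⇔ P′ x) → Quant q A P ⇔ Quant q A P′
quant-⇔ ex  e = mk⇔ (λ (x , p) → x , to (e x) p) (λ (x , p) → x , from (e x) p)
quant-⇔ all e = mk⇔ (λ f x → to (e x) (f x)) (λ f x → from (e x) (f x))

-- The clauses of `⟦_⟧` compute only at a concrete quantifier; a variable `q` is split once here.
⟦quant⟧ : ∀ q {n} m (φ : Formula (suc n)) (ρ : Env m n) →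
  ⟦_⟧ (L m) (quant q φ) ρ ≡ Quant q (Fin (suc m)) (λ x → ⟦_⟧ (L m) φ (x ∷ ρ))
⟦quant⟧ ex  m φ ρ = refl
⟦quant⟧ all m φ ρ = refl

⟦quant⟧-⇔ : ∀ q {n} m {φ : Formula (suc n)} (ρ : Env m n) {P : Fin (suc m) → Set} →
  (∀ x → ⟦_⟧ (L m) φ (x ∷ ρ) ⇔ P x) → ⟦_⟧ (L m) (quant q φ) ρ ⇔ Quant q (Fin (suc m)) P
⟦quant⟧-⇔ ex  m ρ = quant-⇔ ex
⟦quant⟧-⇔ all m ρ = quant-⇔ all

∀-toℕ : ∀ {m} (P : ℕ → Set) → ((x : Fin (suc m)) → P (toℕ x)) → ∀ {y} → y ≤ m → P y
∀-toℕ P f y≤m = subst P (toℕ-fromℕ< (s≤s y≤m)) (f (fromℕ< (s≤s y≤m)))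

∃-toℕ : ∀ {m} (P : ℕ → Set) {y} → y ≤ m → P y → Σ[ x ∈ Fin (suc m) ] P (toℕ x)
∃-toℕ P y≤m p = fromℕ< (s≤s y≤m) , subst P (sym (toℕ-fromℕ< (s≤s y≤m))) p

IfLess : ℕ → ℕ → Set → Set → Set
IfLess i j A B = (i < j → A) × (¬ i < j → B)

ifLess-⇔ : ∀ i j {A A′ B B′ : Set} → A ⇔ A′ → B ⇔ B′ → IfLess i j A B ⇔ IfLess i j A′ B′
ifLess-⇔ i j e f = mk⇔ (λ (g , h) → to e ∘ g , to f ∘ h) (λ (g , h) → from e ∘ g , from f ∘ h)

-- `P` ranges over all `m`, since one formula must be correct in every `L m`.
record Definable {n : ℕ} (Q : List Quantifier) (P : ∀ m → Env m n → Set) : Set where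
  constructor defined
  field
    formula : Formula n
    prenex  : PrenexWith formula Q
    correct : ∀ m ρ → ⟦_⟧ (L m) formula ρ ⇔ P m ρ

open Definable

definable-⇔ : ∀ {n Q} {P P′ : ∀ m → Env m n → Set} →
  (∀ m ρ → P m ρ ⇔ P′ m ρ) → Definable Q P → Definable Q P′
definable-⇔ e (defined φ p c) = defined φ p
  λ m ρ → mk⇔ (to (e m ρ) ∘ to (c m ρ)) (from (c m ρ) ∘ from (e m ρ))

quantified : ∀ q {n Q} {P : ∀ m → Env m (suc n) → Set} → Definable Q P →
  Definable (q ∷ Q) (λ m ρ → Quant q (Fin (suc m)) (λ x → P m (x ∷ ρ)))
quantified q (defined φ p c) = defined (quant q φ) (prefix q p)
  λ m ρ → ⟦quant⟧-⇔ q m ρ (λ x → c m (x ∷ ρ))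

-- Dummy quantifiers over the nonempty carriers pad a constant to any prefix, so that it can stand
-- as a branch beside a formula with prefix `Q`.
never : ∀ Q {n} → Definable {n} Q (λ _ _ → ⊥)
never []        = defined ⊥′ (matrix ⊥′) λ _ _ → mk⇔ (λ ()) (λ ())
never (ex ∷ Q)  = definable-⇔ (λ _ _ → mk⇔ proj₂ (λ ())) (quantified ex (never Q))
never (all ∷ Q) = definable-⇔ (λ _ _ → mk⇔ (λ f → f Fin.zero) (λ ())) (quantified all (never Q))

always : ∀ Q {n} → Definable {n} Q (λ _ _ → ⊤)
always []        = defined (¬′ ⊥′) (matrix (¬′ ⊥′)) λ _ _ → mk⇔ _ (λ _ ())
always (ex ∷ Q)  = definable-⇔ (λ _ _ → mk⇔ _ (λ _ → Fin.zero , tt)) (quantified ex (always Q))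
always (all ∷ Q) = definable-⇔ (λ _ _ → mk⇔ _ (λ _ _ → tt)) (quantified all (always Q))

-- The guard does not mention the bound variables, so it moves inward past a quantifier common to
-- both branches. Two formulas with prefix `Q` thus share a single copy of `Q`.
ifLess : ∀ {n Q} (s t : Term n) {φ ψ} → PrenexWith φ Q → PrenexWith ψ Q →
  Definable Q (λ m ρ → IfLess (val m s ρ) (val m t ρ) (⟦_⟧ (L m) φ ρ) (⟦_⟧ (L m) ψ ρ))
ifLess s t {φ} {ψ} (matrix p) (matrix r) = defined
  ((s <′ t ⇒′ φ) ∧′ (¬′ (s <′ t) ⇒′ ψ))
  (matrix (((s <′ t) ⇒′ p) ∧′ ((¬′ (s <′ t)) ⇒′ r)))
  λ _ _ → mk⇔ (λ x → x) (λ x → x)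
ifLess s t (prefix {φ} q p) (prefix {ψ} .q r) =
  definable-⇔ step (quantified q (ifLess (weaken s) (weaken t) p r))
  where
  weakened : ∀ m x ρ {A B : Set} →
    IfLess (val m (weaken s) (x ∷ ρ)) (val m (weaken t) (x ∷ ρ)) A B ⇔ IfLess (val m s ρ) (val m t ρ) A B
  weakened m x ρ rewrite val-weaken m s x ρ | val-weaken m t x ρ = mk⇔ (λ x → x) (λ x → x)

  inside : ∀ q i j {C : Set} {A B : C → Set} → C →
    Quant q C (λ x → IfLess i j (A x) (B x)) ⇔ IfLess i j (Quant q C A) (Quant q C B)
  inside all i j c = mk⇔
    (λ f → (λ i<j x → proj₁ (f x) i<j) , (λ i≮j x → proj₂ (f x) i≮j))
    (λ (g , h) x → (λ i<j → g i<j x) , (λ i≮j → h i≮j x))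
  inside ex i j {C} {A} {B} c = mk⇔
    (λ (x , g , h) → (λ i<j → x , g i<j) , (λ i≮j → x , h i≮j)) choose
    where
    -- Only the branch selected by the guard supplies a witness, so `i < j` is decided first.
    choose : IfLess i j (Σ C A) (Σ C B) → Σ C (λ x → IfLess i j (A x) (B x))
    choose (g , h) with i <? j
    ... | yes i<j = proj₁ (g i<j) , (λ _ → proj₂ (g i<j)) , contradiction i<j
    ... | no  i≮j = proj₁ (h i≮j) , (λ i<j → contradiction i<j i≮j) , (λ _ → proj₂ (h i≮j))

  step : ∀ m ρ →
    Quant q (Fin (suc m)) (λ x → IfLess (val m (weaken s) (x ∷ ρ)) (val m (weaken t) (x ∷ ρ))
                                         (⟦_⟧ (L m) φ (x ∷ ρ)) (⟦_⟧ (L m) ψ (x ∷ ρ)))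
    ⇔ IfLess (val m s ρ) (val m t ρ) (⟦_⟧ (L m) (quant q φ) ρ) (⟦_⟧ (L m) (quant q ψ) ρ)
  step m ρ rewrite ⟦quant⟧ q m φ ρ | ⟦quant⟧ q m ψ ρ = mk⇔
    (to (inside q _ _ Fin.zero) ∘ to (quant-⇔ q (λ x → weakened m x ρ)))
    (from (quant-⇔ q (λ x → weakened m x ρ)) ∘ from (inside q _ _ Fin.zero))

cases : ∀ {n Q} (s t : Term n) {P P′ : ∀ m → Env m n → Set} → Definable Q P → Definable Q P′ →
  Definable Q (λ m ρ → IfLess (val m s ρ) (val m t ρ) (P m ρ) (P′ m ρ))
cases s t (defined φ p c) (defined ψ r d) =
  definable-⇔ (λ m ρ → ifLess-⇔ _ _ (c m ρ) (d m ρ)) (ifLess s t p r)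

notLess : ∀ {n} Q (s t : Term n) → Definable Q (λ m ρ → ¬ val m s ρ < val m t ρ)
notLess Q s t = definable-⇔ (λ _ _ → mk⇔ proj₁ (λ s≮t → s≮t , _)) (cases s t (never Q) (always Q))

-- Negation of prenex formulas

decide : ∀ {n} (φ : Formula n) m ρ → Dec (⟦_⟧ (L m) φ ρ)
decide (s ≈′ t)      m ρ = _ Finₚ.≟ _
decide (s <′ t)      m ρ = _ Finₚ.<? _
decide ⊥′            m ρ = no λ ()
decide (¬′ φ)        m ρ = ¬? (decide φ m ρ)
decide (φ ∧′ ψ)      m ρ = decide φ m ρ ×-dec decide ψ m ρ
decide (φ ∨′ ψ)      m ρ = decide φ m ρ ⊎-dec decide ψ m ρ
decide (φ ⇒′ ψ)      m ρ = decide φ m ρ →-dec decide ψ m ρ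
decide (quant ex φ)  m ρ = any? λ x → decide φ m (x ∷ ρ)
decide (quant all φ) m ρ = all? λ x → decide φ m (x ∷ ρ)

-- A refuted `all` yields a counterexample constructively, since formulas are decidable and carriers
-- finite.
negate : ∀ {n Q} {φ : Formula n} → PrenexWith φ Q →
  Definable (map dual Q) (λ m ρ → ¬ ⟦_⟧ (L m) φ ρ)
negate (matrix {φ} p)     = defined (¬′ φ) (matrix (¬′ p)) λ _ _ → mk⇔ (λ x → x) (λ x → x)
negate (prefix ex p)      = definable-⇔
  (λ m ρ → mk⇔ (λ f (x , a) → f x a) (λ f x a → f (x , a)))
  (quantified all (negate p))
negate (prefix {φ} all p) = definable-⇔
  (λ m ρ → mk⇔ (λ (x , ¬a) f → ¬a (f x)) (¬∀⟶∃¬ _ _ (λ x → decide φ m (x ∷ ρ))))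
  (quantified ex (negate p))

negation : ∀ {n} q k {P : ∀ m → Env m n → Set} →
  Definable (alternating q k) P → Definable (alternating (dual q) k) (λ m ρ → ¬ P m ρ)
negation q k {P} (defined φ p c) = subst (λ Q → Definable Q (λ m ρ → ¬ P m ρ)) (map-dual-alternating q k)
  (definable-⇔ (λ m ρ → mk⇔ (_∘ from (c m ρ)) (_∘ to (c m ρ))) (negate p))

-- One quantifier shared by two tasks

Rel⁴ : Set₁
Rel⁴ = (s x z t : ℕ) → Set

Under : ∀ {n} → Term n → Term n → Term n → Rel⁴ → ∀ m → Env m (suc n) → Set
Under s z t R m ρ =
  R (val m (weaken s) ρ) (val m (var Fin.zero) ρ) (val m (weaken z) ρ) (val m (weaken t) ρ)

-- `R` is the task for `x` left of `z`, `R′` the task for the other `x`; the common type `Rel⁴` lets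
-- each pick the endpoints of its own interval.
split : ∀ q {n Q} (s z t : Term n) (R R′ : Rel⁴) →
  Definable Q (Under s z t R) → Definable Q (Under s z t R′) →
  Definable (q ∷ Q) (λ m ρ → Quant q (Fin (suc m)) λ x →
    IfLess (toℕ x) (val m z ρ) (R  (val m s ρ) (toℕ x) (val m z ρ) (val m t ρ))
                               (R′ (val m s ρ) (toℕ x) (val m z ρ) (val m t ρ)))
split q s z t R R′ d d′ = definable-⇔ (λ m ρ → quant-⇔ q (λ x → strengthen m x ρ))
  (quantified q (cases (var Fin.zero) (weaken z) d d′))
  where
  strengthen : ∀ m x ρ →
    IfLess (toℕ x) (val m (weaken z) (x ∷ ρ)) (Under s z t R m (x ∷ ρ)) (Under s z t R′ m (x ∷ ρ)) ⇔
    IfLess (toℕ x) (val m z ρ) (R  (val m s ρ) (toℕ x) (val m z ρ) (val m t ρ))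
                               (R′ (val m s ρ) (toℕ x) (val m z ρ) (val m t ρ))
  strengthen m x ρ rewrite val-weaken m s x ρ | val-weaken m z x ρ | val-weaken m t x ρ =
    mk⇔ (λ x → x) (λ x → x)

-- Bounding distances

-- The distance bound reached with `n` alternating quantifiers beginning with `q`: an existential
-- midpoint adds two half bounds, a universal one gains a further unit.
cap : Quantifier → ℕ → ℕ
cap q   zero    = 0
cap ex  (suc n) = 2 * cap all n
cap all (suc n) = suc (2 * cap ex n)

⌊/2⌋-≤ : ∀ {k c} → k ≤ 2 * c → ⌊ k /2⌋ ≤ c
⌊/2⌋-≤ {k} {c} k≤2c = subst (⌊ k /2⌋ ≤_) (⌊2n/2⌋≡n c) (⌊n/2⌋-mono k≤2c)

⌈/2⌉-≤ : ∀ {k c} → k ≤ 2 * c → ⌈ k /2⌉ ≤ c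
⌈/2⌉-≤ {k} {c} k≤2c = subst (⌈ k /2⌉ ≤_) (⌈2n/2⌉≡n c) (⌈n/2⌉-mono k≤2c)

halves : ∀ k s → ⌈ k /2⌉ + (⌊ k /2⌋ + s) ≡ k + s
halves k s = trans (sym (+-assoc ⌈ k /2⌉ ⌊ k /2⌋ s))
  (cong (_+ s) (trans (+-comm ⌈ k /2⌉ ⌊ k /2⌋) (⌊n/2⌋+⌈n/2⌉≡n k)))

Halving : ℕ → (s z t : ℕ) → Set
Halving k s z t = z ≤ ⌊ k /2⌋ + s × t ≤ ⌈ k /2⌉ + z

halving-sound : ∀ k {s z t} → Halving k s z t → t ≤ k + s
halving-sound k {s} (p , q) = ≤-trans q (≤-trans (+-monoʳ-≤ ⌈ k /2⌉ p) (≤-reflexive (halves k s)))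

-- The witness is the leftmost point from `s` on that lies within `⌈ k /2⌉` of `t`. Keeping it in
-- `[s, t)` later tells apart the witnesses of adjacent intervals.
halving-complete : ∀ k {s t} → s < t → t ≤ k + s → Σ[ z ∈ ℕ ] s ≤ z × z < t × Halving k s z t
halving-complete zero    s<t t≤s = contradiction t≤s (<⇒≱ s<t)
-- For `k > 0` the subtracted `⌈ k /2⌉` is at least 1, so `z` stays strictly below `t`.
halving-complete k@(suc k′) {s} {t@(suc _)} s<t t≤k+s = s ⊔ z , m≤m⊔n s z , ⊔-lub s<t (s≤s (m∸n≤m _ ⌊ k′ /2⌋)) ,
  ⊔-lub (m≤n+m s _) (m≤n+o⇒m∸n≤o t ⌈ k /2⌉ (≤-trans t≤k+s (≤-reflexive (sym (halves k s))))) ,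
  ≤-trans (m≤n+m∸n t ⌈ k /2⌉) (+-monoʳ-≤ ⌈ k /2⌉ (m≤n⊔m s z))
  where z = t ∸ ⌈ k /2⌉

-- The guards exclude y = s and y = t, where the interval on one side of y is
-- empty and has no room for the existential witness of halving-complete.
Gap : ℕ → (s y t : ℕ) → Set
Gap k s y t = s < y → y < t → y ≤ ⌊ k /2⌋ + s ⊎ t ≤ ⌈ k /2⌉ + y

-- Failing both alternatives takes at least `⌊ k /2⌋ + 1` on one side and `⌈ k /2⌉ + 1` on the
-- other, so `k + 2` in total; hence the bound `suc k`.
gap-sound : ∀ k {s y t} → t ≤ suc k + s → Gap k s y t
gap-sound k {s} {y} {t} t≤1+k+s _ _ with y ≤? ⌊ k /2⌋ + s
... | yes p = inj₁ p
... | no ¬p = inj₂ (begin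
  t                                ≤⟨ t≤1+k+s ⟩
  suc (k + s)                      ≡⟨ cong suc (sym (halves k s)) ⟩
  suc (⌈ k /2⌉ + (⌊ k /2⌋ + s))    ≡⟨ sym (+-suc ⌈ k /2⌉ _) ⟩
  ⌈ k /2⌉ + suc (⌊ k /2⌋ + s)      ≤⟨ +-monoʳ-≤ ⌈ k /2⌉ (≰⇒> ¬p) ⟩
  ⌈ k /2⌉ + y                      ∎)
  where open ≤-Reasoning

gap-complete : ∀ k {s t} → (∀ y → s ≤ y → y < t → Gap k s y t) → t ≤ suc k + s
gap-complete k {s} {t} gaps with t ≤? suc k + s
... | yes p = p
... | no ¬p = contradiction (gaps y (<⇒≤ s<y) y<t s<y y<t)
  [ 1+n≰n , (λ t≤ → ¬p (≤-trans t≤ (≤-reflexive same))) ]′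
  where
  -- One test point suffices: the first that is too far from `s` for the left alternative.
  y = suc (⌊ k /2⌋ + s)
  s<y : s < y
  s<y = s≤s (m≤n+m s _)
  y<t : y < t
  y<t = ≤-<-trans (s≤s (+-monoˡ-≤ s (⌊n/2⌋≤n k))) (≰⇒> ¬p)
  same : ⌈ k /2⌉ + y ≡ suc (k + s)
  same = trans (+-suc ⌈ k /2⌉ _) (cong suc (halves k s))

-- What remains of `t ≤ a + s` under the universal `y`. `Gap k` belongs to the bound `suc k`, so the
-- bound 0 needs its own clause.
Step : ℕ → (s y t : ℕ) → Set
Step zero    s y t = ¬ s < t
Step (suc k) s y t = Gap k s y t

step-sound : ∀ a {s y t} → t ≤ a + s → Step a s y t
step-sound zero    t≤s = ≤⇒≯ t≤s
step-sound (suc k) = gap-sound k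

step-complete : ∀ a {s t} → (∀ y → s ≤ y → y < t → Step a s y t) → t ≤ a + s
step-complete zero {s} steps = ≮⇒≥ λ s<t → steps s ≤-refl s<t s<t
step-complete (suc k) = gap-complete k

-- Alternating formulas for halvings and gaps

mutual
  -- Each half of `k` is at most `cap all n`. For `n > 0` the shared universal variable uses one
  -- quantifier and leaves `step` with one fewer.
  halving : ∀ {i} n {k} → k ≤ 2 * cap all n → (s z t : Term i) →
    Definable (alternating all n) (λ m ρ → Halving k (val m s ρ) (val m z ρ) (val m t ρ))
  halving zero z≤n s z t = definable-⇔
    (λ _ _ → mk⇔ (λ (f , g) → ≮⇒≥ f , ≮⇒≥ (g f)) (λ (p , q) → ≤⇒≯ p , λ _ → ≤⇒≯ q))
    (cases s z (never []) (notLess [] z t))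
  halving (suc n) {k} k≤ s z t = definable-⇔ (λ m ρ → merge m (val≤ m z ρ) (val≤ m t ρ))
    (split all s z t (λ s y z _ → Step ⌊ k /2⌋ s y z) (λ _ y z t → Step ⌈ k /2⌉ z y t)
      (step n (⌊/2⌋-≤ k≤) (weaken s) (var Fin.zero) (weaken z))
      (step n (⌈/2⌉-≤ k≤) (weaken z) (var Fin.zero) (weaken t)))
    where
    -- Numbers below `z` or `t` are at most `m`, so they are elements of the order and the universal
    -- quantifier reaches them.
    merge : ∀ m {s z t} → z ≤ m → t ≤ m →
      ((y : Fin (suc m)) → IfLess (toℕ y) z (Step ⌊ k /2⌋ s (toℕ y) z) (Step ⌈ k /2⌉ z (toℕ y) t))
      ⇔ Halving k s z t
    merge m {s} {z} {t} z≤m t≤m = mk⇔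
      (λ f → step-complete ⌊ k /2⌋ (λ y _ y<z → proj₁ (∀-toℕ Pieces f (≤-trans (<⇒≤ y<z) z≤m)) y<z) ,
             step-complete ⌈ k /2⌉ (λ y z≤y y<t → proj₂ (∀-toℕ Pieces f (≤-trans (<⇒≤ y<t) t≤m)) (≤⇒≯ z≤y)))
      (λ (p , q) _ → (λ _ → step-sound ⌊ k /2⌋ p) , (λ _ → step-sound ⌈ k /2⌉ q))
      where
      Pieces : ℕ → Set
      Pieces y = IfLess y z (Step ⌊ k /2⌋ s y z) (Step ⌈ k /2⌉ z y t)

  step : ∀ {i} n {a} → a ≤ cap all (suc n) → (s y t : Term i) →
    Definable (alternating ex n) (λ m ρ → Step a (val m s ρ) (val m y ρ) (val m t ρ))
  step n {zero}  _  s y t = notLess _ s t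
  step n {suc k} k≤ s y t = gap n (s≤s⁻¹ k≤) s y t

  gap : ∀ {i} n {k} → k ≤ 2 * cap ex n → (s y t : Term i) →
    Definable (alternating ex n) (λ m ρ → Gap k (val m s ρ) (val m y ρ) (val m t ρ))
  -- With `k = 0` both alternatives contradict the guards, so the gap says only that `y` is not
  -- strictly between `s` and `t`.
  gap zero z≤n s y t = definable-⇔ (λ _ _ → mk⇔
      (λ (f , _) s<y y<t → contradiction y<t (f s<y))
      (λ g → (λ s<y y<t → [ <⇒≱ s<y , <⇒≱ y<t ]′ (g s<y y<t)) , _))
    (cases s y (notLess [] y t) (always []))
  gap (suc n) {k} k≤ s y t = definable-⇔ (λ m ρ → merge m (val≤ m y ρ) (val≤ m t ρ))
    (cases s y
      (cases y t
        (split ex s y t (λ s x y _ → Halving ⌊ k /2⌋ s x y) (λ _ x y t → Halving ⌈ k /2⌉ y x t)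
          (halving n (⌊/2⌋-≤ k≤) (weaken s) (var Fin.zero) (weaken y))
          (halving n (⌈/2⌉-≤ k≤) (weaken y) (var Fin.zero) (weaken t)))
        (always _))
      (always _))
    where
    merge : ∀ m {s y t} → y ≤ m → t ≤ m →
      IfLess s y (IfLess y t
        (Σ[ x ∈ Fin (suc m) ] IfLess (toℕ x) y (Halving ⌊ k /2⌋ s (toℕ x) y) (Halving ⌈ k /2⌉ y (toℕ x) t))
        ⊤) ⊤
      ⇔ Gap k s y t
    merge m {s} {y} {t} y≤m t≤m = mk⇔ sound complete
      where
      Pieces : ℕ → Set
      Pieces x = IfLess x y (Halving ⌊ k /2⌋ s x y) (Halving ⌈ k /2⌉ y x t)

      sound : IfLess s y (IfLess y t (Σ[ x ∈ Fin (suc m) ] Pieces (toℕ x)) ⊤) ⊤ → Gap k s y t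
      sound (f , _) s<y y<t with proj₁ (f s<y) y<t
      ... | x , g , h with toℕ x <? y
      ... | yes x<y = inj₁ (halving-sound ⌊ k /2⌋ (g x<y))
      ... | no  x≮y = inj₂ (halving-sound ⌈ k /2⌉ (h x≮y))

      -- A witness for the left interval lies below `y`, one for the right does not; in either case
      -- the other branch of `Pieces` is vacuous.
      point : s < y → y < t → y ≤ ⌊ k /2⌋ + s ⊎ t ≤ ⌈ k /2⌉ + y → Σ[ x ∈ Fin (suc m) ] Pieces (toℕ x)
      point s<y _ (inj₁ p) with halving-complete ⌊ k /2⌋ s<y p
      ... | z , _ , z<y , h = ∃-toℕ Pieces (<⇒≤ (<-≤-trans z<y y≤m)) ((λ _ → h) , contradiction z<y)
      point _ y<t (inj₂ p) with halving-complete ⌈ k /2⌉ y<t p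
      ... | z , y≤z , z<t , h =
        ∃-toℕ Pieces (<⇒≤ (<-≤-trans z<t t≤m)) ((λ z<y → contradiction y≤z (<⇒≱ z<y)) , λ _ → h)

      complete : Gap k s y t → IfLess s y (IfLess y t (Σ[ x ∈ Fin (suc m) ] Pieces (toℕ x)) ⊤) ⊤
      complete g = (λ s<y → (λ y<t → point s<y y<t (g s<y y<t)) , _) , _

-- The guard provides the nonempty interval in which `halving-complete` finds its point.
atMost : ∀ {i} n {k} → k ≤ cap ex n → (s t : Term i) →
  Definable (alternating ex n) (λ m ρ → val m s ρ < val m t ρ → val m t ρ ≤ k + val m s ρ)
atMost zero z≤n s t = definable-⇔
  (λ _ _ → mk⇔ (λ s≮t s<t → contradiction s<t s≮t) (λ f s<t → <⇒≱ s<t (f s<t)))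
  (notLess [] s t)
atMost (suc n) {k} k≤ s t = definable-⇔ (λ m ρ → mk⇔
    (λ (f , _) s<t → sound (f s<t))
    (λ f → (λ s<t → complete m (val≤ m t ρ) s<t (f s<t)) , _))
  -- There is a single task, so it fills both branches of the split.
  (cases s t (split ex s t t R R d d) (always _))
  where
  R : Rel⁴
  R s x _ t = Halving k s x t

  d : Definable (alternating all n) (Under s t t R)
  d = halving n k≤ (weaken s) (var Fin.zero) (weaken t)

  sound : ∀ {m s t} → Σ[ x ∈ Fin (suc m) ] IfLess (toℕ x) t (R s (toℕ x) t t) (R s (toℕ x) t t) → t ≤ k + s
  sound {t = t} (x , g , h) with toℕ x <? t
  ... | yes x<t = halving-sound k (g x<t)
  ... | no  x≮t = halving-sound k (h x≮t)

  complete : ∀ m {s t} → t ≤ m → s < t → t ≤ k + s →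
    Σ[ x ∈ Fin (suc m) ] IfLess (toℕ x) t (R s (toℕ x) t t) (R s (toℕ x) t t)
  complete m {s} {t} t≤m s<t p with halving-complete k s<t p
  ... | z , _ , z<t , h = ∃-toℕ (λ x → IfLess x t (R s x t t) (R s x t t))
    (<⇒≤ (<-≤-trans z<t t≤m)) ((λ _ → h) , (λ _ → h))

-- Exact length

cap-ex-odd : ∀ j → cap ex (suc (j * 2)) ≡ cap ex (j * 2)
cap-ex-odd zero    = refl
cap-ex-odd (suc j) = cong (λ c → 2 * suc (2 * c)) (cap-ex-odd j)

exactly : ∀ j {k} → suc k ≤ cap ex (j * 2) →
  Definable {0} (alternating all (suc (j * 2))) (λ m _ → 0 < m → m ≡ suc k)
exactly j {k} k< = definable-⇔ equivalent
  -- Negating a `halving` formula, whose prefix begins with `all`, gives the same prefix as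
  -- `atMost`, so both fit under the outer `all`.
  (split all min max max (λ s x z _ → ¬ Halving k s x z) (λ s _ _ t → s < t → t ≤ suc k + s)
    (negation all (j * 2) (halving (j * 2) k≤ min (var Fin.zero) max))
    (atMost (j * 2) k< min max))
  where
  k≤ : k ≤ 2 * cap all (j * 2)
  -- `2 * cap all (j * 2)` unfolds from `cap ex (suc (j * 2))`, and the additional final `ex` leaves
  -- the cap unchanged.
  k≤ = ≤-trans (n≤1+n k) (≤-trans k< (≤-reflexive (sym (cap-ex-odd j))))

  equivalent : ∀ m (ρ : Env m 0) →
    ((x : Fin (suc m)) → IfLess (toℕ x) (toℕ (Fin.fromℕ m))
      (¬ Halving k 0 (toℕ x) (toℕ (Fin.fromℕ m)))
      (0 < toℕ (Fin.fromℕ m) → toℕ (Fin.fromℕ m) ≤ suc k + 0))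
    ⇔ (0 < m → m ≡ suc k)
  equivalent m _ rewrite toℕ-fromℕ m = mk⇔ exact bounds
    where
    Body : ℕ → Set
    Body x = IfLess x m (¬ Halving k 0 x m) (0 < m → m ≤ suc k + 0)

    exact : ((x : Fin (suc m)) → Body (toℕ x)) → 0 < m → m ≡ suc k
    exact f 0<m = ≤-antisym
      (subst (m ≤_) (+-identityʳ (suc k)) (proj₂ (∀-toℕ Body f ≤-refl) (<-irrefl refl) 0<m))
      -- A length of at most `k` would have a halving point below `m`, which the first branch
      -- rejects.
      (≰⇒> λ m≤k → let (z , _ , z<m , h) = halving-complete k 0<m (≤-trans m≤k (m≤m+n k 0))
                   in proj₁ (∀-toℕ Body f (<⇒≤ z<m)) z<m h)

    bounds : (0 < m → m ≡ suc k) → (x : Fin (suc m)) → Body (toℕ x)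
    bounds e x =
      (λ x<m h → <⇒≱ (≤-reflexive (sym (e (≤-<-trans z≤n x<m))))
                     (subst (m ≤_) (+-identityʳ k) (halving-sound k h))) ,
      (λ _ 0<m → ≤-trans (≤-reflexive (e 0<m)) (m≤m+n (suc k) 0))

-- Comparison with q*

≤-from-⌊/2⌋ : ∀ {n c} → ⌊ n /2⌋ ≤ c → n ≤ suc (2 * c)
≤-from-⌊/2⌋ {n} {c} h = begin
  n                              ≡⟨ sym (⌊n/2⌋+⌈n/2⌉≡n n) ⟩
  ⌊ n /2⌋ + ⌈ n /2⌉              ≤⟨ +-mono-≤ h (≤-trans (⌈n/2⌉≤1+⌊n/2⌋ n) (s≤s h)) ⟩
  c + suc c                      ≡⟨ +-suc c c ⟩
  suc (c + c)                    ≡⟨ cong (λ d → suc (c + d)) (sym (+-identityʳ c)) ⟩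
  suc (2 * c)                    ∎
  where
  open ≤-Reasoning
  ⌈n/2⌉≤1+⌊n/2⌋ : ∀ n → ⌈ n /2⌉ ≤ suc ⌊ n /2⌋
  ⌈n/2⌉≤1+⌊n/2⌋ zero          = z≤n
  ⌈n/2⌉≤1+⌊n/2⌋ (suc zero)    = ≤-refl
  ⌈n/2⌉≤1+⌊n/2⌋ (suc (suc n)) = s≤s (⌈n/2⌉≤1+⌊n/2⌋ n)

≤-from-⌈/2⌉ : ∀ {n c} → ⌈ n /2⌉ ≤ c → n ≤ 2 * c
≤-from-⌈/2⌉ {n} {c} h = begin
  n                    ≡⟨ sym (⌊n/2⌋+⌈n/2⌉≡n n) ⟩
  ⌊ n /2⌋ + ⌈ n /2⌉    ≤⟨ +-mono-≤ (≤-trans (⌊n/2⌋≤⌈n/2⌉ n) h) h ⟩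
  c + c                ≡⟨ cong (c +_) (sym (+-identityʳ c)) ⟩
  2 * c                ∎
  where open ≤-Reasoning

m+1≤1+n⇒m≤n : ∀ {m n} → m + 1 ≤ suc n → m ≤ n
m+1≤1+n⇒m≤n {m} {n} h = s≤s⁻¹ (subst (_≤ suc n) (+-comm m 1) h)

mutual
  -- The four bounds follow the recurrences: each halving of `ℓ` costs one quantifier and flips both
  -- the subscript and the parity of the budget. Undoing it turns a bound `c` into `2c + 1` for the
  -- floor and `2c` for the ceiling.
  q*∀-even-bound : ∀ j ℓ → q*∀ ℓ ≤ j * 2 → ℓ ≤ cap ex (j * 2)
  q*∀-even-bound j       0 _ = z≤n
  q*∀-even-bound (suc j) 1 _ = s≤s z≤n
  q*∀-even-bound (suc j) 2 _ = *-monoʳ-≤ 2 (s≤s (z≤n {2 * cap ex (j * 2)}))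
  q*∀-even-bound zero    ℓ@(suc (suc (suc _))) h =
    contradiction (subst (_≤ 0) (trans (q*∀-step ℓ (s≤s (s≤s (s≤s z≤n)))) (+-comm _ 1)) h) λ ()
  q*∀-even-bound (suc j) ℓ@(suc (suc (suc _))) h = begin
    ℓ                                  ≤⟨ ≤-from-⌊/2⌋ (q*∃-odd-bound j ⌊ ℓ /2⌋
                                            (m+1≤1+n⇒m≤n (subst (_≤ suc j * 2) (q*∀-step ℓ (s≤s (s≤s (s≤s z≤n)))) h))) ⟩
    -- One unit of slack: with `c = cap ex (j * 2)` this is `4c + 1`, while the cap is `4c + 2`.
    suc (2 * (2 * cap ex (j * 2)))     ≤⟨ n≤1+n _ ⟩
    2 + 2 * (2 * cap ex (j * 2))       ≡⟨ sym (*-suc 2 _) ⟩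
    2 * suc (2 * cap ex (j * 2))       ∎
    where open ≤-Reasoning

  q*∃-even-bound : ∀ j ℓ → q*∃ ℓ ≤ j * 2 → ℓ ≤ cap ex (j * 2)
  q*∃-even-bound j       0 _ = z≤n
  q*∃-even-bound (suc j) 1 _ = s≤s z≤n
  q*∃-even-bound zero    ℓ@(suc (suc _)) h =
    contradiction (subst (_≤ 0) (trans (q*∃-step ℓ (s≤s (s≤s z≤n))) (+-comm _ 1)) h) λ ()
  q*∃-even-bound (suc j) ℓ@(suc (suc _)) h = ≤-from-⌈/2⌉ (q*∀-odd-bound j ⌈ ℓ /2⌉
    (m+1≤1+n⇒m≤n (subst (_≤ suc j * 2) (q*∃-step ℓ (s≤s (s≤s z≤n))) h)))

  q*∀-odd-bound : ∀ j ℓ → q*∀ ℓ ≤ suc (j * 2) → ℓ ≤ suc (2 * cap ex (j * 2))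
  q*∀-odd-bound j       0 _ = z≤n
  q*∀-odd-bound j       1 _ = s≤s z≤n
  q*∀-odd-bound zero    2 (s≤s ())
  q*∀-odd-bound (suc j) 2 _ = s≤s (s≤s z≤n)
  q*∀-odd-bound j ℓ@(suc (suc (suc _))) h = ≤-from-⌊/2⌋ (q*∃-even-bound j ⌊ ℓ /2⌋
    (m+1≤1+n⇒m≤n (subst (_≤ suc (j * 2)) (q*∀-step ℓ (s≤s (s≤s (s≤s z≤n)))) h)))

  q*∃-odd-bound : ∀ j ℓ → q*∃ ℓ ≤ suc (j * 2) → ℓ ≤ 2 * cap ex (j * 2)
  q*∃-odd-bound j       0 _ = z≤n
  q*∃-odd-bound zero    1 (s≤s ())
  q*∃-odd-bound (suc j) 1 _ = s≤s z≤n
  q*∃-odd-bound j ℓ@(suc (suc _)) h = ≤-from-⌈/2⌉ (q*∀-even-bound j ⌈ ℓ /2⌉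
    (m+1≤1+n⇒m≤n (subst (_≤ suc (j * 2)) (q*∃-step ℓ (s≤s (s≤s z≤n))) h)))

q*-bound : ∀ j ℓ → q* ℓ ≤ j * 2 → ℓ ≤ cap ex (j * 2)
q*-bound j ℓ h with ⊓-sel (q*∃ ℓ) (q*∀ ℓ)
... | inj₁ e = q*∃-even-bound j ℓ (subst (_≤ j * 2) e h)
... | inj₂ e = q*∀-even-bound j ℓ (subst (_≤ j * 2) e h)

n≤⌈n/2⌉*2 : ∀ n → n ≤ ⌈ n /2⌉ * 2
n≤⌈n/2⌉*2 n = subst (n ≤_) (*-comm 2 ⌈ n /2⌉) (≤-from-⌈/2⌉ ≤-refl)

⌈n/2⌉*2≤1+n : ∀ n → ⌈ n /2⌉ * 2 ≤ suc n
⌈n/2⌉*2≤1+n zero          = z≤n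
⌈n/2⌉*2≤1+n (suc zero)    = ≤-refl
⌈n/2⌉*2≤1+n (suc (suc n)) = s≤s (s≤s (⌈n/2⌉*2≤1+n n))

mainTheorem5 : (ℓ : ℕ) → ℓ ≥ 1 →
    Σ[ φ ∈ Sentence ] Σ[ Q ∈ List Quantifier ]
    PrenexWith φ Q
    × L ℓ ⊨ φ
    × ((m : ℕ) → m ≥ 1 → m ≢ ℓ → ¬ (L m ⊨ φ))
    × length Q ≤ q* ℓ + 2
    × Linked _≢_ Q
    × last Q ≡ just all
mainTheorem5 ℓ@(suc k) _ =
  formula d , alternating all (suc (j * 2)) , prenex d ,
  from (correct d ℓ []) (λ _ → refl) ,
  (λ m m≥1 m≢ℓ ⊨φ → m≢ℓ (to (correct d m []) ⊨φ m≥1)) ,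
  short ,
  linked-alternating all (suc (j * 2)) ,
  last-alternating j
  where
  -- An even number of quantifiers after the outer `all` makes the prefix end with `all`. The
  -- rounding costs at most one quantifier and the outer `all` one more.
  j = ⌈ q* ℓ /2⌉
  d = exactly j (q*-bound j ℓ (n≤⌈n/2⌉*2 (q* ℓ)))
  short : length (alternating all (suc (j * 2))) ≤ q* ℓ + 2
  short rewrite length-alternating all (suc (j * 2)) | +-comm (q* ℓ) 2 = s≤s (⌈n/2⌉*2≤1+n (q* ℓ))
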